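{- Let $\sigma$ be a special standard $P$-morphism on $\mathcal A$, with $\sigma(x)=pq_x$ for all $x\in\mathcal A$, and let $\mathbf t$ be a rich infinite word over $\mathcal A$. Let $h$ be minimal such that all palindromic factors of $\mathbf t$ of length at most $2$ occur in the prefix $\mathbf t_h$ of length $h$. Then $\sigma(\mathbf t)$ is rich if and only if $\sigma(\mathbf t_h)p$ is rich.
   Context: A finite word $w$ is rich if it has exactly $|w|+1$ distinct palindromic factors (including the empty word); an infinite word is rich if all its factors are rich. A standard $P$-morphism is a morphism $\sigma$ on $\mathcal A$ for which there is a palindrome $p$ (possibly empty) with $\sigma(x)=pq_x$ for all $x$, where each $q_x$ is a palindrome (possibly empty), or, when $p$ is non-empty, $q_x=\pi_x^{ -1}$ with $\pi_x$ a proper palindromic suffix of $p$ (i.e. $\sigma(x)$ is $p$ with suffix $\pi_x$ removed). It is special if (1) the words $\sigma(x)$, $x\in\mathcal A$, end with pairwise different letters, and (2) whenever $\sigma(x)p=pq_xp$, $x\in\mathcal A$, occurs as a factor of some word $\sigma(y_1y_2\cdots y_n)p$ ($y_i\in\mathcal A$), this occurrence is the occurrence of $\sigma(y_m)p$ starting right after $\sigma(y_1\cdots y_{m-1})$, for some $1\le m\le n$. -}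

module Defs where

open import Data.Nat using (ℕ; _≤_; _<_)
open import Data.Fin using (Fin; toℕ)
open import Data.List using (List; []; _∷_; _++_; length; reverse; map; upTo; concatMap; take; lookup; _∷ʳ_)
open import Data.List.Membership.Propositional using (_∈_)
open import Data.List.Relation.Unary.Unique.Propositional using (Unique)
open import Data.Product using (Σ; ∃; _×_; _,_)
open import Data.Sum using (_⊎_)
open import Relation.Binary.PropositionalEquality using (_≡_; _≢_)
open import Relation.Nullary using (¬_)
open import Function.Bundles using (_⇔_)
open import Function.Definitions using (Injective)

Word : ℕ → Set
Word k = List (Fin k)

InfWord : ℕ → Set
InfWord k = ℕ → Fin k

IsPal : ∀ {k} → Word k → Set
IsPal w = reverse w ≡ w

Factor : ∀ {k} → Word k → Word k → Set
Factor {k} u w = Σ (Word k) λ x → Σ (Word k) λ y → x ++ u ++ y ≡ w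

Suffix : ∀ {k} → Word k → Word k → Set
Suffix {k} u w = Σ (Word k) λ x → x ++ u ≡ w

NumPalFactors : ∀ {k} → Word k → ℕ → Set
NumPalFactors {k} w n =
  Σ (List (Word k)) λ L →
    Unique L × (∀ u → (u ∈ L) ⇔ (Factor u w × IsPal u)) × length L ≡ n

Rich : ∀ {k} → Word k → Set
Rich w = NumPalFactors w (ℕ.suc (length w))

pref : ∀ {k} → InfWord k → ℕ → Word k
pref t n = map t (upTo n)

FactorInf : ∀ {k} → Word k → InfWord k → Set
FactorInf u t = ∃ λ n → Factor u (pref t n)

RichInf : ∀ {k} → InfWord k → Set
RichInf t = ∀ u → FactorInf u t → Rich u

Morphism : ℕ → Set
Morphism k = Fin k → Word k

img : ∀ {k} → Morphism k → Word k → Word k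
img σ w = concatMap σ w

-- σ(t) for an infinite word t is the word whose factors are the factors of
-- the σ(t_n), n ∈ ℕ; σ(t) is rich iff all these factors are rich.
FactorImg : ∀ {k} → Word k → Morphism k → InfWord k → Set
FactorImg u σ t = ∃ λ n → Factor u (img σ (pref t n))

RichImg : ∀ {k} → Morphism k → InfWord k → Set
RichImg σ t = ∀ u → FactorImg u σ t → Rich u

StandardP : ∀ {k} → Morphism k → Word k → Set
StandardP {k} σ p = IsPal p × (∀ x →
    (Σ (Word k) λ q → IsPal q × σ x ≡ p ++ q)
  ⊎ (p ≢ [] × Σ (Word k) λ π → IsPal π × Suffix π p × length π < length p × σ x ++ π ≡ p))

Special : ∀ {k} → Morphism k → Word k → Set
Special {k} σ p =
  (Σ (Fin k → Fin k) λ f → (∀ x → Σ (Word k) λ w → σ x ≡ w ∷ʳ f x) × Injective _≡_ _≡_ f)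
  × (∀ x (ys : List (Fin k)) (u v : Word k) → u ++ (σ x ++ p) ++ v ≡ img σ ys ++ p →
       Σ (Fin (length ys)) λ i → u ≡ img σ (take (toℕ i) ys) × σ x ++ p ≡ σ (lookup ys i) ++ p)

ShortPalsIn : ∀ {k} → InfWord k → ℕ → Set
ShortPalsIn t h = ∀ u → FactorInf u t → IsPal u → length u ≤ 2 → Factor u (pref t h)

MinShortPalsIn : ∀ {k} → InfWord k → ℕ → Set
MinShortPalsIn t h = ShortPalsIn t h × (∀ h' → h' < h → ¬ ShortPalsIn t h')

{-# OPTIONS --safe #-}
-- A word is rich iff each of its letters, read from left to right, completes a palindrome that did not
-- occur before.  If t is rich and n > h, then the palindrome completed by the last letter x of t_n has
-- length at least 3, since all shorter ones occur in t_h; so it is x R x with R non-empty.  The identity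
-- σ(x) p = p reverse(σ(x)) makes σ(R) p a palindrome, and σ(t_n) p is σ(t_{n-1}) p followed by
-- reverse(σ(x)).  For each non-empty prefix c of reverse(σ(x)), reverse(c) σ(R) p c is then a palindromic
-- suffix of σ(t_{n-1}) p c.  It is new: σ(R) p synchronises by speciality, and the letters around it are
-- the last letter of σ(x), which determines x, so an earlier occurrence would yield one of x R x in t.
-- Hence richness of σ(t_h) p propagates to all σ(t_n) p.  Conversely σ(t_h) p is a factor of σ(t), as p
-- is a prefix of every long enough σ(u).

module Submission where

open import Defs
open import Data.Nat using (ℕ; suc; _+_; _≤_; z≤n; s≤s; _≤?_)
open import Data.Nat.Properties using (≤-refl; ≤-reflexive; ≤-trans; ≤-total; m≤n⇒m≤1+n; <-irrefl; <⇒≤; ≰⇒>; +-comm; +-suc; +-identityʳ; +-mono-≤; m≤n+m; module ≤-Reasoning)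
open import Data.Fin using (Fin; zero; suc; toℕ)
open import Data.Fin.Properties using (_≟_; injective⇒≤)
open import Data.List using (List; []; _∷_; _++_; _∷ʳ_; [_]; length; reverse; applyUpTo; take; lookup; initLast; _∷ʳ′_)
open import Data.List.Properties using (≡-dec; ++-assoc; ++-identityʳ; ++-cancelˡ; ++-cancelʳ; ++-conicalˡ; ++-conicalʳ; ∷-injective; ∷-injectiveˡ; ∷-injectiveʳ; ∷ʳ-injective; ∷ʳ-injectiveˡ; ∷ʳ-injectiveʳ; length-++; length-reverse; length-applyUpTo; map-upTo; applyUpTo-∷ʳ; concatMap-++; reverse-++; reverse-involutive; unfold-reverse)
open import Data.List.Membership.Propositional using (_∈_)
open import Data.List.Membership.Propositional.Properties using (∈-lookup)
open import Data.List.Membership.Setoid.Properties using (index-injective)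
open import Data.List.Relation.Unary.All using ([])
import Data.List.Relation.Unary.All as All
open import Data.List.Relation.Unary.AllPairs using ([]; _∷_)
open import Data.List.Relation.Unary.Any using (here; there; index)
open import Data.List.Relation.Unary.Unique.Propositional using (Unique)
open import Data.List.Reverse using (Reverse; []; _∶_∶ʳ_; reverseView)
open import Data.Product using (Σ; ∃; ∃₂; _×_; _,_; proj₁; proj₂)
open import Data.Sum using (_⊎_; inj₁; inj₂)
open import Function.Base using (_∘_)
open import Function.Bundles using (_⇔_; mk⇔; Equivalence)
open import Relation.Binary.PropositionalEquality using (_≡_; refl; sym; trans; cong; cong₂; subst; setoid; module ≡-Reasoning)
open import Relation.Nullary using (¬_; Dec; yes; no; contradiction)
open import Relation.Nullary.Decidable using (map′; _×-dec_; ¬?; decidable-stable)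

-- Comparing two factorisations of a list; counting without repetition.

module _ {A : Set} where

  prefix-of-longer : ∀ (a c : List A) {b d} → a ++ b ≡ c ++ d → length c ≤ length a → ∃ λ s → a ≡ c ++ s
  prefix-of-longer a [] eq le = a , refl
  prefix-of-longer (x ∷ a) (y ∷ c) eq (s≤s le)
    with refl , eq′ ← ∷-injective eq
    with s , refl ← prefix-of-longer a c eq′ le = s , refl

  suffix-of-longer : ∀ (a c : List A) {b d} → a ++ b ≡ c ++ d → length d ≤ length b → ∃ λ s → b ≡ s ++ d
  suffix-of-longer []      c        eq le = c , eq
  suffix-of-longer (x ∷ a) (y ∷ c)  eq le = suffix-of-longer a c (∷-injectiveʳ eq) le
  suffix-of-longer (x ∷ a) [] {b}   eq le = contradiction
    (≤-trans (s≤s (≤-trans (m≤n+m (length b) (length a)) (≤-reflexive (sym (length-++ a)))))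
             (≤-trans (≤-reflexive (cong length eq)) le))
    (<-irrefl refl)

  -- `Factor` and `NewPal` are existential statements about cuts of a word. Searching the finitely
  -- many cuts decides both; the counting in `palCover` rests on these decisions.
  split? : {P : List A → List A → Set} → (∀ x y → Dec (P x y)) →
           ∀ w → Dec (∃₂ λ x y → x ++ y ≡ w × P x y)
  split? P? [] = map′ (λ q → [] , [] , refl , q) (λ { ([] , [] , refl , q) → q }) (P? [] [])
  split? {P} P? (a ∷ w) with P? [] (a ∷ w) | split? {λ x → P (a ∷ x)} (λ x y → P? (a ∷ x) y) w
  ... | yes q | _ = yes ([] , a ∷ w , refl , q)
  ... | no _ | yes (x , y , eq , q) = yes (a ∷ x , y , cong (a ∷_) eq , q)
  ... | no ¬q | no ¬r = no λ where
    ([] , y , refl , q) → ¬q q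
    (b ∷ x , y , refl , q) → ¬r (x , y , refl , q)

  lookup-injective : {L : List A} → Unique L → ∀ i j → lookup L i ≡ lookup L j → i ≡ j
  lookup-injective (x∉ ∷ u) zero    zero    eq = refl
  lookup-injective (x∉ ∷ u) zero    (suc j) eq = contradiction eq (All.lookup x∉ (∈-lookup j))
  lookup-injective (x∉ ∷ u) (suc i) zero    eq = contradiction (sym eq) (All.lookup x∉ (∈-lookup i))
  lookup-injective (x∉ ∷ u) (suc i) (suc j) eq = cong suc (lookup-injective u i j eq)

  -- Sending each position of `L` to that of the same entry in `M` is injective, because `L` repeats
  -- nothing.
  unique-⊆⇒length≤ : {L M : List A} → Unique L → (∀ {u} → u ∈ L → u ∈ M) → length L ≤ length M
  unique-⊆⇒length≤ {L} {M} uniq sub = injective⇒≤ {f = λ i → index (sub (∈-lookup {xs = L} i))}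
    λ eq → lookup-injective uniq _ _ (index-injective (setoid A) (sub (∈-lookup _)) (sub (∈-lookup _)) eq)

  take-lookup : ∀ (ys : List A) i → ∃ λ zs → ys ≡ take (toℕ i) ys ++ lookup ys i ∷ zs
  take-lookup (y ∷ ys) zero = ys , refl
  take-lookup (y ∷ ys) (suc i) with zs , eq ← take-lookup ys i = zs , cong (y ∷_) eq

-- Factors and palindromic suffixes of finite words.

module _ {k : ℕ} where

  IsPal? : (u : Word k) → Dec (IsPal u)
  IsPal? u = ≡-dec _≟_ (reverse u) u

  Factor? : (u w : Word k) → Dec (Factor u w)
  Factor? u w = map′
    (λ { (x , _ , refl , _ , y , refl , refl) → x , y , refl })
    (λ { (x , y , refl) → x , u ++ y , refl , u , y , refl , refl })
    (split? (λ _ z → split? (λ v _ → ≡-dec _≟_ v u) z) w)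

  factor-++ʳ : ∀ {u w : Word k} v → Factor u w → Factor u (w ++ v)
  factor-++ʳ {u} v (x , y , refl) = x , y ++ v ,
    sym (trans (++-assoc x (u ++ y) v) (cong (x ++_) (++-assoc u y v)))

  suffix⇒factor : ∀ {u w : Word k} → Suffix u w → Factor u w
  suffix⇒factor {u} (x , refl) = x , [] , cong (x ++_) (++-identityʳ u)

  factor-∷ʳ : ∀ {u : Word k} w a → Factor u (w ∷ʳ a) → Factor u w ⊎ Suffix u (w ∷ʳ a)
  factor-∷ʳ {u} w a (x , y , eq) with initLast y
  ... | []      = inj₂ (x , trans (cong (x ++_) (sym (++-identityʳ u))) eq)
  ... | z ∷ʳ′ b = inj₁ (x , z , ∷ʳ-injectiveˡ (x ++ u ++ z) w
    (trans (++-assoc x (u ++ z) _) (trans (cong (x ++_) (++-assoc u z _)) eq)))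

  pal-suffix⇒prefix : ∀ {s u : Word k} x → IsPal u → IsPal s → u ≡ x ++ s → u ≡ s ++ reverse x
  pal-suffix⇒prefix {s} x pu ps refl = trans (sym pu) (trans (reverse-++ x s) (cong (_++ reverse x) ps))

  -- Reflection in the palindrome `u` moves its proper suffix `s` to the front of `u`, hence clear
  -- of the final letter `a`.
  proper-pal-suffix⇒factor : ∀ {s u w : Word k} {a} b x → IsPal u → IsPal s → u ≡ b ∷ x ++ s →
                             Suffix u (w ∷ʳ a) → Factor s w
  proper-pal-suffix⇒factor {s} {u} {w} {a} b x pu ps eq (y , eq′) =
    y , reverse x , ∷ʳ-injectiveˡ (y ++ s ++ reverse x) w (begin
      (y ++ s ++ reverse x) ∷ʳ b  ≡⟨ ++-assoc y _ _ ⟩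
      y ++ (s ++ reverse x) ∷ʳ b  ≡⟨ cong (y ++_) (++-assoc s _ _) ⟩
      y ++ s ++ reverse x ∷ʳ b    ≡⟨ cong (λ z → y ++ s ++ z) (unfold-reverse b x) ⟨
      y ++ s ++ reverse (b ∷ x)   ≡⟨ cong (y ++_) (pal-suffix⇒prefix (b ∷ x) pu ps eq) ⟨
      y ++ u                      ≡⟨ eq′ ⟩
      w ∷ʳ a                      ∎)
    where open ≡-Reasoning

  pal-ends : ∀ a (u : Word k) b → IsPal (a ∷ u ∷ʳ b) → a ≡ b × IsPal u
  pal-ends a u b pal with e₁ , e₂ ← ∷-injective (trans (sym (reverse-++ (a ∷ u) [ b ])) pal) =
    sym e₁ , ∷ʳ-injectiveˡ _ _ (trans (sym (unfold-reverse a u)) e₂)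

  -- Richness as one new palindrome per letter.

  NewPal : Word k → Fin k → Set
  NewPal w a = Σ (Word k) λ s → IsPal s × Suffix s (w ∷ʳ a) × ¬ Factor s w

  -- The Droubay–Justin–Pirillo characterisation of richness.
  AllNewPals : Word k → Set
  AllNewPals w = ∀ v a z → v ++ a ∷ z ≡ w → NewPal v a

  allNewPals-prefix : ∀ {w} v → AllNewPals (w ++ v) → AllNewPals w
  allNewPals-prefix v new x a z refl = new x a (z ++ v) (sym (++-assoc x (a ∷ z) v))

  allNewPals-++ : ∀ w u → AllNewPals w → (∀ v a z → v ++ a ∷ z ≡ u → NewPal (w ++ v) a) →
                  AllNewPals (w ++ u)
  allNewPals-++ w u old new v a z eq with length w ≤? length v
  ... | yes le with s , refl ← prefix-of-longer v w eq le =
    new s a z (++-cancelˡ w _ _ (trans (sym (++-assoc w s _)) eq))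
  ... | no w≰v with prefix-of-longer w v (sym eq) (<⇒≤ (≰⇒> w≰v))
  ...   | []    , refl = contradiction (≤-reflexive (cong length (++-identityʳ v))) w≰v
  ...   | b ∷ s , refl with refl ← ∷-injectiveˡ (++-cancelˡ v _ _ (trans eq (++-assoc v (b ∷ s) u))) =
    old v b s refl

  NewPal? : ∀ w a → Dec (NewPal w a)
  NewPal? w a = map′
    (λ { (x , s , eq , ps , new) → s , ps , (x , eq) , new })
    (λ { (s , ps , (x , eq) , new) → x , s , eq , ps , new })
    (split? (λ _ s → IsPal? s ×-dec ¬? (Factor? s w)) (w ∷ʳ a))

  -- Two palindromic suffixes of `w ∷ʳ a` are nested, and a strictly shorter one also occurs earlier
  -- by reflection. So only the longest can be new.
  newPal-unique : ∀ {u w a} → (new : NewPal w a) → IsPal u → Suffix u (w ∷ʳ a) →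
                  u ≡ proj₁ new ⊎ Factor u w
  newPal-unique {u} (s , ps , (x , eqx) , s∉w) pu (y , eqy) with ≤-total (length s) (length u)
  ... | inj₁ le with suffix-of-longer y x (trans eqy (sym eqx)) le
  ...   | []    , eq = inj₁ eq
  ...   | b ∷ z , eq = contradiction (proper-pal-suffix⇒factor b z pu ps eq (y , eqy)) s∉w
  newPal-unique {u} (s , ps , (x , eqx) , s∉w) pu (y , eqy) | inj₂ le
    with suffix-of-longer x y (trans eqx (sym eqy)) le
  ...   | []    , eq = inj₁ (sym eq)
  ...   | b ∷ z , eq = inj₂ (proper-pal-suffix⇒factor b z ps pu eq (x , eqx))

  length-∷ʳ : ∀ (w : Word k) a → length (w ∷ʳ a) ≡ suc (length w)
  length-∷ʳ w a = trans (length-++ w) (+-comm (length w) 1)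

  factor-[] : ∀ {u : Word k} → Factor u [] → u ≡ []
  factor-[] {u} (x , y , eq) = ++-conicalˡ u y (++-conicalʳ x _ eq)

  -- Starting from the empty word alone, each letter adds exactly one palindrome to the list, by
  -- `newPal-unique`.
  allNewPals⇒rich : ∀ w → AllNewPals w → Rich w
  allNewPals⇒rich w = go (reverseView w)
    where
    go : ∀ {w} → Reverse w → AllNewPals w → Rich w
    go [] _ = [ [] ] , [] ∷ [] ,
      (λ u → mk⇔ (λ { (here refl) → ([] , [] , refl) , refl }) (λ (f , _) → here (factor-[] f))) , refl
    go (w ∶ r ∶ʳ a) new
      with L , uniq , L⇔ , len ← go r (allNewPals-prefix [ a ] new)
      with N@(s , ps , sw , s∉w) ← new w a [] refl =
      s ∷ L
      , All.tabulate (λ { u∈L refl → s∉w (proj₁ (Equivalence.to (L⇔ _) u∈L)) }) ∷ uniq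
      , (λ u → mk⇔
          (λ { (here refl) → suffix⇒factor sw , ps
             ; (there u∈L) → let f , pu = Equivalence.to (L⇔ u) u∈L in factor-++ʳ [ a ] f , pu })
          (λ (f , pu) → from u f pu))
      , cong suc (trans len (sym (length-∷ʳ w a)))
      where
      from : ∀ u → Factor u (w ∷ʳ a) → IsPal u → u ∈ s ∷ L
      from u f pu with factor-∷ʳ w a f
      ... | inj₁ g = there (Equivalence.from (L⇔ u) (g , pu))
      ... | inj₂ g with newPal-unique N pu g
      ...   | inj₁ eq = here eq
      ...   | inj₂ g′ = there (Equivalence.from (L⇔ u) (g′ , pu))

  -- Only an upper bound on the number of palindromic factors is wanted, so `cover` may repeat words
  -- or contain others. `new⊎small` remembers whether some letter completed nothing new; the bound
  -- is then sharper by one from there on.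
  record PalCover (w : Word k) : Set where
    field
      cover     : List (Word k)
      covers    : ∀ u → Factor u w → IsPal u → u ∈ cover
      bound     : length cover ≤ suc (length w)
      new⊎small : AllNewPals w ⊎ length cover ≤ length w

  palCover : ∀ w → PalCover w
  palCover w = go (reverseView w)
    where
    go : ∀ {w} → Reverse w → PalCover w
    go [] = record
      { cover = [ [] ] ; covers = λ u f _ → here (factor-[] f) ; bound = ≤-refl
      ; new⊎small = inj₁ λ { [] _ _ () ; (_ ∷ _) _ _ () } }
    go (w ∶ r ∶ʳ a) with go r | NewPal? w a
    ... | C | yes N@(s , _) = record
      { cover = s ∷ cover ; covers = cov
      ; bound = subst (λ n → suc (length cover) ≤ suc n) (sym (length-∷ʳ w a)) (s≤s bound)
      ; new⊎small = small new⊎small }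
      where
      open PalCover C
      cov : ∀ u → Factor u (w ∷ʳ a) → IsPal u → u ∈ s ∷ cover
      cov u f pu with factor-∷ʳ w a f
      ... | inj₁ g = there (covers u g pu)
      ... | inj₂ g with newPal-unique N pu g
      ...   | inj₁ eq = here eq
      ...   | inj₂ g′ = there (covers u g′ pu)
      small : AllNewPals w ⊎ length cover ≤ length w →
              AllNewPals (w ∷ʳ a) ⊎ suc (length cover) ≤ length (w ∷ʳ a)
      small (inj₁ new) = inj₁ (allNewPals-++ w [ a ] new λ where
        [] _ _ refl → subst (λ v → NewPal v a) (sym (++-identityʳ w)) N
        (_ ∷ []) _ _ ()
        (_ ∷ _ ∷ _) _ _ ())
      small (inj₂ le) = inj₂ (subst (suc (length cover) ≤_) (sym (length-∷ʳ w a)) (s≤s le))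
    ... | C | no ¬N = record
      { cover = cover ; covers = cov
      ; bound = m≤n⇒m≤1+n le ; new⊎small = inj₂ le }
      where
      open PalCover C
      le = subst (length cover ≤_) (sym (length-∷ʳ w a)) bound
      cov : ∀ u → Factor u (w ∷ʳ a) → IsPal u → u ∈ cover
      cov u f pu with factor-∷ʳ w a f
      ... | inj₁ g = covers u g pu
      -- If `u` did not occur in `w`, it would be a new palindrome, which `¬N` excludes.
      ... | inj₂ g = covers u (decidable-stable (Factor? u w) λ u∉w → ¬N (u , pu , g , u∉w)) pu

  -- A letter without a new palindrome would leave a cover of at most `length w` words, too few for
  -- the `suc (length w)` distinct palindromes in `L`.
  rich⇒allNewPals : ∀ w → Rich w → AllNewPals w
  rich⇒allNewPals w (L , uniq , L⇔ , len) with palCover w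
  ... | record { new⊎small = inj₁ new } = new
  ... | record { covers = covers ; new⊎small = inj₂ le } = contradiction
    (≤-trans (≤-reflexive (sym len))
      (≤-trans (unique-⊆⇒length≤ uniq λ u∈L → let f , pu = Equivalence.to (L⇔ _) u∈L in covers _ f pu) le))
    (<-irrefl refl)

  -- Richness under reversal and passage to factors.

  factor-reverse : ∀ {u w : Word k} → IsPal u → Factor u w → Factor u (reverse w)
  factor-reverse {u} pu (x , y , refl) = reverse y , reverse x , sym (begin
    reverse (x ++ u ++ y)               ≡⟨ reverse-++ x (u ++ y) ⟩
    reverse (u ++ y) ++ reverse x       ≡⟨ cong (_++ reverse x) (reverse-++ u y) ⟩
    (reverse y ++ reverse u) ++ reverse x ≡⟨ ++-assoc (reverse y) _ _ ⟩
    reverse y ++ reverse u ++ reverse x ≡⟨ cong (λ v → reverse y ++ v ++ reverse x) pu ⟩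
    reverse y ++ u ++ reverse x         ∎)
    where open ≡-Reasoning

  rich-reverse : ∀ {w : Word k} → Rich w → Rich (reverse w)
  rich-reverse {w} (L , uniq , L⇔ , len) = L , uniq ,
    (λ u → mk⇔
      (λ u∈L → let f , pu = Equivalence.to (L⇔ u) u∈L in factor-reverse pu f , pu)
      (λ (f , pu) → Equivalence.from (L⇔ u) (subst (Factor u) (reverse-involutive w) (factor-reverse pu f) , pu)))
    , trans len (cong suc (sym (length-reverse w)))

  rich-prefix : ∀ (u : Word k) {v} → Rich (u ++ v) → Rich u
  rich-prefix u {v} r = allNewPals⇒rich u (allNewPals-prefix v (rich⇒allNewPals (u ++ v) r))

  -- `AllNewPals` reads from the left and passes to prefixes; suffixes are reached through reversal,
  -- which keeps the set of palindromic factors.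
  rich-suffix : ∀ (u : Word k) {v} → Rich (u ++ v) → Rich v
  rich-suffix u {v} r = subst Rich (reverse-involutive v)
    (rich-reverse (rich-prefix (reverse v) (subst Rich (reverse-++ u v) (rich-reverse r))))

  rich-factor : ∀ {u w : Word k} → Factor u w → Rich w → Rich u
  rich-factor {u} (x , y , refl) r = rich-prefix u (rich-suffix x r)

  -- Prefixes of infinite words.

  pref-suc : ∀ (t : InfWord k) n → pref t (suc n) ≡ pref t n ∷ʳ t n
  pref-suc t n = trans (map-upTo t (suc n)) (trans (sym (applyUpTo-∷ʳ t n)) (cong (_∷ʳ t n) (sym (map-upTo t n))))

  pref-+ : ∀ (t : InfWord k) m n → ∃ λ z → length z ≡ n × pref t (m + n) ≡ pref t m ++ z
  pref-+ t m n = applyUpTo (t ∘ (m +_)) n , length-applyUpTo _ n ,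
    trans (map-upTo t (m + n)) (trans (go t m) (cong (_++ applyUpTo (t ∘ (m +_)) n) (sym (map-upTo t m))))
    where
    go : ∀ (s : InfWord k) m → applyUpTo s (m + n) ≡ applyUpTo s m ++ applyUpTo (s ∘ (m +_)) n
    go s ℕ.zero = refl
    go s (suc m) = cong (s 0 ∷_) (go (s ∘ suc) m)

-- Images under a special standard P-morphism.

module SpecialMorphism {k : ℕ} (σ : Morphism k) (p : Word k) (standard : StandardP σ p) (special : Special σ p) where

  f : Fin k → Fin k
  f = proj₁ (proj₁ special)

  f-last : ∀ x → Σ (Word k) λ w → σ x ≡ w ∷ʳ f x
  f-last = proj₁ (proj₂ (proj₁ special))

  f-injective : ∀ {x y} → f x ≡ f y → x ≡ y
  f-injective = proj₂ (proj₂ (proj₁ special))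

  img-++ : ∀ u v → img σ (u ++ v) ≡ img σ u ++ img σ v
  img-++ = concatMap-++ σ

  img-[_] : ∀ x → img σ [ x ] ≡ σ x
  img-[ x ] = ++-identityʳ (σ x)

  img-∷ʳ : ∀ u x → img σ (u ∷ʳ x) ≡ img σ u ++ σ x
  img-∷ʳ u x = trans (img-++ u [ x ]) (cong (img σ u ++_) img-[ x ])

  σ-injective : ∀ {x y} → σ x ≡ σ y → x ≡ y
  σ-injective {x} {y} eq with u , eu ← f-last x with v , ev ← f-last y =
    f-injective (∷ʳ-injectiveʳ u v (trans (sym eu) (trans eq ev)))

  length-img : ∀ u → length u ≤ length (img σ u)
  length-img [] = z≤n
  length-img (x ∷ u) with v , eq ← f-last x = begin
    1 + length u                   ≤⟨ +-mono-≤ (s≤s z≤n) (length-img u) ⟩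
    suc (length v) + length (img σ u) ≡⟨ cong (_+ length (img σ u)) (trans (cong length eq) (length-∷ʳ v (f x))) ⟨
    length (σ x) + length (img σ u) ≡⟨ length-++ (σ x) ⟨
    length (σ x ++ img σ u)        ∎
    where open ≤-Reasoning

  open ≡-Reasoning

  img≡[] : ∀ {u} → [] ≡ img σ u → u ≡ []
  img≡[] {[]}    _  = refl
  img≡[] {x ∷ u} eq with () ← ≤-trans (length-img (x ∷ u)) (≤-reflexive (cong length (sym eq)))

  -- If `σ x` is `p ++ q`, both sides are `p ++ q ++ p`. If `σ x ++ π` is `p`, both are
  -- `σ x ++ π ++ reverse (σ x)`, since `p` and `π` are palindromes.
  σ-p : ∀ x → σ x ++ p ≡ p ++ reverse (σ x)
  σ-p x with proj₂ standard x
  ... | inj₁ (q , pq , eq) = begin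
    σ x ++ p                   ≡⟨ cong (_++ p) eq ⟩
    (p ++ q) ++ p              ≡⟨ ++-assoc p q p ⟩
    p ++ q ++ p                ≡⟨ cong (p ++_) (cong₂ _++_ pq (proj₁ standard)) ⟨
    p ++ reverse q ++ reverse p ≡⟨ cong (p ++_) (reverse-++ p q) ⟨
    p ++ reverse (p ++ q)      ≡⟨ cong (λ v → p ++ reverse v) eq ⟨
    p ++ reverse (σ x)         ∎
  ... | inj₂ (_ , π , pπ , _ , _ , eq) = begin
    σ x ++ p                       ≡⟨ cong (σ x ++_) (proj₁ standard) ⟨
    σ x ++ reverse p               ≡⟨ cong (λ v → σ x ++ reverse v) eq ⟨
    σ x ++ reverse (σ x ++ π)      ≡⟨ cong (σ x ++_) (reverse-++ (σ x) π) ⟩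
    σ x ++ reverse π ++ reverse (σ x) ≡⟨ cong (λ v → σ x ++ v ++ reverse (σ x)) pπ ⟩
    σ x ++ π ++ reverse (σ x)      ≡⟨ ++-assoc (σ x) π _ ⟨
    (σ x ++ π) ++ reverse (σ x)    ≡⟨ cong (_++ reverse (σ x)) eq ⟩
    p ++ reverse (σ x)             ∎

  -- Applying `σ-p` letter by letter carries `p` across the whole image.
  p-reverse-img : ∀ u → p ++ reverse (img σ u) ≡ img σ (reverse u) ++ p
  p-reverse-img [] = ++-identityʳ p
  p-reverse-img (x ∷ u) = begin
    p ++ reverse (σ x ++ img σ u)              ≡⟨ cong (p ++_) (reverse-++ (σ x) (img σ u)) ⟩
    p ++ reverse (img σ u) ++ reverse (σ x)    ≡⟨ ++-assoc p _ _ ⟨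
    (p ++ reverse (img σ u)) ++ reverse (σ x)  ≡⟨ cong (_++ reverse (σ x)) (p-reverse-img u) ⟩
    (img σ (reverse u) ++ p) ++ reverse (σ x)  ≡⟨ ++-assoc (img σ (reverse u)) _ _ ⟩
    img σ (reverse u) ++ p ++ reverse (σ x)    ≡⟨ cong (img σ (reverse u) ++_) (σ-p x) ⟨
    img σ (reverse u) ++ σ x ++ p              ≡⟨ ++-assoc (img σ (reverse u)) _ _ ⟨
    (img σ (reverse u) ++ σ x) ++ p            ≡⟨ cong (_++ p) (img-∷ʳ (reverse u) x) ⟨
    img σ (reverse u ∷ʳ x) ++ p                ≡⟨ cong (λ v → img σ v ++ p) (unfold-reverse x u) ⟨
    img σ (reverse (x ∷ u)) ++ p               ∎

  img-p-pal : ∀ {u} → IsPal u → IsPal (img σ u ++ p)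
  img-p-pal {u} pu = begin
    reverse (img σ u ++ p)          ≡⟨ reverse-++ (img σ u) p ⟩
    reverse p ++ reverse (img σ u)  ≡⟨ cong (_++ reverse (img σ u)) (proj₁ standard) ⟩
    p ++ reverse (img σ u)          ≡⟨ p-reverse-img u ⟩
    img σ (reverse u) ++ p          ≡⟨ cong (λ v → img σ v ++ p) pu ⟩
    img σ u ++ p                    ∎

  img-p-prefix : ∀ u → ∃ λ s → img σ u ++ p ≡ p ++ s
  img-p-prefix u = reverse (img σ (reverse u)) ,
    sym (trans (p-reverse-img (reverse u)) (cong (λ v → img σ v ++ p) (reverse-involutive u)))

  img-∷-p : ∀ x u → ∃ λ s → img σ (x ∷ u) ++ p ≡ (σ x ++ p) ++ s
  img-∷-p x u with s , eq ← img-p-prefix u = s ,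
    trans (++-assoc (σ x) _ _) (trans (cong (σ x ++_) eq) (sym (++-assoc (σ x) p s)))

  -- Recovering preimages from factors of images.

  synchronise-head : ∀ u x v ys → u ++ (σ x ++ p) ++ v ≡ img σ ys ++ p →
                     ∃₂ λ A C → ys ≡ A ++ x ∷ C × u ≡ img σ A
  synchronise-head u x v ys eq with i , eu , ex ← proj₂ special x ys u v eq
    with C , eys ← take-lookup ys i
    with refl ← σ-injective (++-cancelʳ p (σ x) _ ex) = take (toℕ i) ys , C , eys , eu

  -- Mutual recursion on `R`. Once the block of `x` is located, cancelling everything up to its end
  -- leaves the image of the remaining letters at the very start, where the preimage before it has
  -- to be empty.
  synchronise-prefix : ∀ R v ys → (img σ R ++ p) ++ v ≡ img σ ys ++ p → ∃ λ C → ys ≡ R ++ C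
  synchronise-∷ : ∀ u x R v ys → u ++ (img σ (x ∷ R) ++ p) ++ v ≡ img σ ys ++ p →
                  ∃₂ λ A C → ys ≡ A ++ x ∷ R ++ C × u ≡ img σ A

  synchronise-prefix [] v ys eq = ys , refl
  synchronise-prefix (x ∷ R) v ys eq with A , C , eys , eA ← synchronise-∷ [] x R v ys eq
    with refl ← img≡[] {A} eA = C , eys

  synchronise-∷ u x R v ys eq
    with s , es ← img-∷-p x R
    with A , C , refl , refl ← synchronise-head u x (s ++ v) ys
           (trans (cong (u ++_) (trans (sym (++-assoc (σ x ++ p) s v)) (cong (_++ v) (sym es)))) eq)
    with D , refl ← synchronise-prefix R v C
           (++-cancelˡ (σ x) _ _ (++-cancelˡ (img σ A) _ _ (begin
             img σ A ++ σ x ++ (img σ R ++ p) ++ v   ≡⟨ cong (img σ A ++_) (++-assoc (σ x) (img σ R ++ p) v) ⟨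
             img σ A ++ (σ x ++ img σ R ++ p) ++ v   ≡⟨ cong (λ z → img σ A ++ z ++ v) (++-assoc (σ x) (img σ R) p) ⟨
             img σ A ++ (img σ (x ∷ R) ++ p) ++ v    ≡⟨ eq ⟩
             img σ (A ++ x ∷ C) ++ p                 ≡⟨ cong (_++ p) (img-++ A (x ∷ C)) ⟩
             (img σ A ++ img σ (x ∷ C)) ++ p         ≡⟨ ++-assoc (img σ A) _ p ⟩
             img σ A ++ (σ x ++ img σ C) ++ p        ≡⟨ cong (img σ A ++_) (++-assoc (σ x) _ p) ⟩
             img σ A ++ σ x ++ img σ C ++ p          ∎)))
    = A , D , refl , refl

  last-letter : ∀ {u x} A → u ∷ʳ f x ≡ img σ A → ∃ λ A′ → A ≡ A′ ∷ʳ x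
  last-letter {u} {x} A eq with initLast A
  ... | [] with () ← ++-conicalʳ u [ f x ] eq
  ... | A′ ∷ʳ′ y with w , ew ← f-last y
      with refl ← f-injective (∷ʳ-injectiveʳ u (img σ A′ ++ w) (trans eq (trans (img-∷ʳ A′ y)
             (trans (cong (img σ A′ ++_) ew) (sym (++-assoc (img σ A′) w _)))))) = A′ , refl

  reverse-σ : ∀ x → ∃ λ w → reverse (σ x) ≡ f x ∷ w
  reverse-σ x with w , ew ← f-last x = reverse w , trans (cong reverse ew) (reverse-++ w [ f x ])

  -- By `σ-p`, `img σ (y ∷ C) ++ p` starts with `p` followed by the first letter of `reverse (σ y)`,
  -- which is `f y`; so the letter after `p` reveals `y`.
  next-letter : ∀ {v x} C → p ++ f x ∷ v ≡ img σ C ++ p → ∃ λ C′ → C ≡ x ∷ C′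
  next-letter {v} {x} [] eq with () ← ++-cancelˡ p (f x ∷ v) [] (trans eq (sym (++-identityʳ p)))
  next-letter {v} {x} (y ∷ C) eq with s , es ← img-∷-p y C with w , ew ← reverse-σ y
    with refl ← f-injective (∷-injectiveˡ (++-cancelˡ p (f x ∷ v) (f y ∷ w ++ s) (begin
      p ++ f x ∷ v                 ≡⟨ trans eq es ⟩
      (σ y ++ p) ++ s              ≡⟨ cong (_++ s) (σ-p y) ⟩
      (p ++ reverse (σ y)) ++ s    ≡⟨ ++-assoc p _ s ⟩
      p ++ reverse (σ y) ++ s      ≡⟨ cong (λ z → p ++ z ++ s) ew ⟩
      p ++ f y ∷ w ++ s            ∎))) = C , refl

  -- Speciality speaks of full blocks `σ r ++ p`, hence the non-empty middle `r ∷ R`. One letter on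
  -- either side then identifies the neighbours: the left one ends `σ x`, the right one follows `p`.
  synchronise : ∀ u x r R y v ys → u ∷ʳ f x ++ (img σ (r ∷ R) ++ p) ++ f y ∷ v ≡ img σ ys ++ p →
                ∃₂ λ A C → ys ≡ A ∷ʳ x ++ (r ∷ R) ++ y ∷ C × u ∷ʳ f x ≡ img σ (A ∷ʳ x)
  synchronise u x r R y v ys eq
    with B , D , refl , eB ← synchronise-∷ (u ∷ʳ f x) r R (f y ∷ v) ys eq
    with A , refl ← last-letter B eB
    with C , refl ← next-letter {v} {y} D (++-cancelˡ (img σ (r ∷ R)) _ _ (++-cancelˡ (u ∷ʳ f x) _ _ (begin
      u ∷ʳ f x ++ img σ (r ∷ R) ++ p ++ f y ∷ v        ≡⟨ cong (u ∷ʳ f x ++_) (++-assoc (img σ (r ∷ R)) p _) ⟨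
      u ∷ʳ f x ++ (img σ (r ∷ R) ++ p) ++ f y ∷ v      ≡⟨ eq ⟩
      img σ (A ∷ʳ x ++ (r ∷ R) ++ D) ++ p              ≡⟨ cong (_++ p) (img-++ (A ∷ʳ x) _) ⟩
      (img σ (A ∷ʳ x) ++ img σ ((r ∷ R) ++ D)) ++ p    ≡⟨ cong₂ (λ z z′ → (z ++ z′) ++ p) eB (sym (img-++ (r ∷ R) D)) ⟨
      (u ∷ʳ f x ++ img σ (r ∷ R) ++ img σ D) ++ p      ≡⟨ ++-assoc (u ∷ʳ f x) _ p ⟩
      u ∷ʳ f x ++ (img σ (r ∷ R) ++ img σ D) ++ p      ≡⟨ cong (u ∷ʳ f x ++_) (++-assoc (img σ (r ∷ R)) _ p) ⟩
      u ∷ʳ f x ++ img σ (r ∷ R) ++ img σ D ++ p        ∎)))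
    = A , C , refl , eB

  -- Appending one letter that completes a palindrome of length at least three.

  module Step (T : Word k) (x r : Fin k) (R : Word k) (pR : IsPal (r ∷ R))
              (new : ¬ Factor (x ∷ r ∷ R ∷ʳ x) (T ++ x ∷ r ∷ R)) where

    w : Word k
    w = T ++ x ∷ r ∷ R

    core : Word k
    core = img σ (r ∷ R) ++ p

    img-w-p : img σ w ++ p ≡ img σ T ++ σ x ++ core
    img-w-p = begin
      img σ w ++ p                                   ≡⟨ cong (_++ p) (img-++ T (x ∷ r ∷ R)) ⟩
      (img σ T ++ σ x ++ img σ (r ∷ R)) ++ p         ≡⟨ ++-assoc (img σ T) _ p ⟩
      img σ T ++ (σ x ++ img σ (r ∷ R)) ++ p         ≡⟨ cong (img σ T ++_) (++-assoc (σ x) _ p) ⟩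
      img σ T ++ σ x ++ core                         ∎

    img-w-x-p : img σ (w ∷ʳ x) ++ p ≡ (img σ w ++ p) ++ reverse (σ x)
    img-w-x-p = begin
      img σ (w ∷ʳ x) ++ p               ≡⟨ cong (_++ p) (img-∷ʳ w x) ⟩
      (img σ w ++ σ x) ++ p             ≡⟨ ++-assoc (img σ w) _ p ⟩
      img σ w ++ σ x ++ p               ≡⟨ cong (img σ w ++_) (σ-p x) ⟩
      img σ w ++ p ++ reverse (σ x)     ≡⟨ ++-assoc (img σ w) p _ ⟨
      (img σ w ++ p) ++ reverse (σ x)   ∎

    module _ (c z : Word k) (eq : c ++ z ≡ reverse (σ x)) where

      extension : Word k
      extension = reverse c ++ core ++ c

      extension-pal : IsPal extension
      extension-pal = begin
        reverse (reverse c ++ core ++ c)                    ≡⟨ reverse-++ (reverse c) (core ++ c) ⟩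
        reverse (core ++ c) ++ reverse (reverse c)          ≡⟨ cong₂ _++_ (reverse-++ core c) (reverse-involutive c) ⟩
        (reverse c ++ reverse core) ++ c                    ≡⟨ cong (λ v → (reverse c ++ v) ++ c) (img-p-pal pR) ⟩
        (reverse c ++ core) ++ c                            ≡⟨ ++-assoc (reverse c) core c ⟩
        reverse c ++ core ++ c                              ∎

      -- `reverse z ++ reverse c` is `σ x`, so `reverse c` stands immediately before the final
      -- `core` of `img σ w ++ p`.
      extension-suffix : Suffix extension ((img σ w ++ p) ++ c)
      extension-suffix = img σ T ++ reverse z , (begin
        (img σ T ++ reverse z) ++ reverse c ++ core ++ c    ≡⟨ ++-assoc (img σ T) _ _ ⟩
        img σ T ++ reverse z ++ reverse c ++ core ++ c      ≡⟨ cong (img σ T ++_) (++-assoc (reverse z) _ _) ⟨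
        img σ T ++ (reverse z ++ reverse c) ++ core ++ c    ≡⟨ cong (λ v → img σ T ++ v ++ core ++ c) (reverse-++ c z) ⟨
        img σ T ++ reverse (c ++ z) ++ core ++ c            ≡⟨ cong (λ v → img σ T ++ v ++ core ++ c) (trans (cong reverse eq) (reverse-involutive (σ x))) ⟩
        img σ T ++ σ x ++ core ++ c                         ≡⟨ cong (img σ T ++_) (++-assoc (σ x) core c) ⟨
        img σ T ++ (σ x ++ core) ++ c                       ≡⟨ ++-assoc (img σ T) _ c ⟨
        (img σ T ++ σ x ++ core) ++ c                       ≡⟨ cong (_++ c) img-w-p ⟨
        (img σ w ++ p) ++ c                                 ∎)

    -- An earlier occurrence of the extension contains f x · σ(R) p · f x (R standing for r ∷ R), hence synchronises
    -- with an occurrence of x R x in w ∷ʳ x; the latter can only be the suffix, which ends too late.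
    extension-new : ∀ v a z (eq : v ∷ʳ a ++ z ≡ reverse (σ x)) →
                    ¬ Factor (extension (v ∷ʳ a) z eq) ((img σ w ++ p) ++ v)
    extension-new v a z eq (X , Y , eqf) = occurrence (head v eq)
      where
      c = v ∷ʳ a

      head : ∀ v → v ∷ʳ a ++ z ≡ reverse (σ x) → ∃ λ d → v ∷ʳ a ≡ f x ∷ d
      head v e with s , es ← reverse-σ x with v | trans e es
      ... | []    | e′ = [] , cong [_] (∷-injectiveˡ e′)
      ... | b ∷ u | e′ = u ∷ʳ a , cong (_∷ u ∷ʳ a) (∷-injectiveˡ e′)

      shifted : (X ++ reverse c) ++ core ++ c ++ Y ≡ (img σ w ++ p) ++ v
      shifted = begin
        (X ++ reverse c) ++ core ++ c ++ Y   ≡⟨ ++-assoc X _ _ ⟩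
        X ++ reverse c ++ core ++ c ++ Y     ≡⟨ cong (λ s → X ++ reverse c ++ s) (++-assoc core c Y) ⟨
        X ++ reverse c ++ (core ++ c) ++ Y   ≡⟨ cong (X ++_) (++-assoc (reverse c) _ Y) ⟨
        X ++ (reverse c ++ core ++ c) ++ Y   ≡⟨ eqf ⟩
        (img σ w ++ p) ++ v                  ∎

      -- Synchronisation concerns full images followed by `p`, so the part `a ∷ z` of
      -- `reverse (σ x)` still missing is appended.
      completed : (X ++ reverse c) ++ core ++ c ++ Y ++ a ∷ z ≡ img σ (w ∷ʳ x) ++ p
      completed = begin
        (X ++ reverse c) ++ core ++ c ++ Y ++ a ∷ z      ≡⟨ cong (λ s → (X ++ reverse c) ++ core ++ s) (++-assoc c Y _) ⟨
        (X ++ reverse c) ++ core ++ (c ++ Y) ++ a ∷ z    ≡⟨ cong ((X ++ reverse c) ++_) (++-assoc core _ _) ⟨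
        (X ++ reverse c) ++ (core ++ c ++ Y) ++ a ∷ z    ≡⟨ ++-assoc (X ++ reverse c) _ _ ⟨
        ((X ++ reverse c) ++ core ++ c ++ Y) ++ a ∷ z    ≡⟨ cong (_++ a ∷ z) shifted ⟩
        ((img σ w ++ p) ++ v) ++ a ∷ z                   ≡⟨ ++-assoc (img σ w ++ p) v _ ⟩
        (img σ w ++ p) ++ v ++ a ∷ z                     ≡⟨ cong ((img σ w ++ p) ++_) (trans (sym (++-assoc v [ a ] z)) eq) ⟩
        (img σ w ++ p) ++ reverse (σ x)                  ≡⟨ img-w-x-p ⟨
        img σ (w ∷ʳ x) ++ p                              ∎

      eX : ∀ d → c ≡ f x ∷ d → (X ++ reverse d) ∷ʳ f x ≡ X ++ reverse c
      eX d ec = trans (++-assoc X (reverse d) _)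
        (cong (X ++_) (trans (sym (unfold-reverse (f x) d)) (cong reverse (sym ec))))

      occurrence : ¬ ∃ λ d → c ≡ f x ∷ d
      occurrence (d , ec)
        -- Only the two letters `f x` adjacent to `core` are used; the rest of `reverse c` and of
        -- `c` is absorbed into the surrounding words.
        with A , C , ew , eA ← synchronise (X ++ reverse d) x r R x (d ++ Y ++ a ∷ z) (w ∷ʳ x)
               (trans (cong₂ (λ s s′ → s ++ core ++ s′ ++ Y ++ a ∷ z) (eX d ec) (sym ec)) completed)
        with initLast C
      -- A letter `b` remains after the occurrence of `x ∷ r ∷ R ∷ʳ x`, so removing it leaves an
      -- occurrence in `w`.
      ... | C′ ∷ʳ′ b = new (factor A C′ (∷ʳ-injectiveˡ w _ (trans ew (begin
        A ∷ʳ x ++ (r ∷ R) ++ x ∷ C′ ∷ʳ b           ≡⟨ ++-assoc A [ x ] _ ⟩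
        A ++ x ∷ r ∷ R ++ x ∷ C′ ∷ʳ b              ≡⟨ cong (λ s → A ++ x ∷ r ∷ s) (++-assoc R (x ∷ C′) _) ⟨
        A ++ (x ∷ r ∷ R ++ x ∷ C′) ∷ʳ b            ≡⟨ ++-assoc A _ [ b ] ⟨
        (A ++ x ∷ r ∷ R ++ x ∷ C′) ∷ʳ b            ∎))))
        where
        factor : ∀ A C → w ≡ A ++ x ∷ r ∷ R ++ x ∷ C → Factor (x ∷ r ∷ R ∷ʳ x) w
        factor A C e = A , C , trans (cong (λ s → A ++ x ∷ r ∷ s) (++-assoc R [ x ] C)) (sym e)
      -- The occurrence ends `w ∷ʳ x`, so this `core` ends `img σ w ++ p`. Only `v` follows it, too
      -- short for `c`, which is `v ∷ʳ a`.
      ... | [] = v∷ʳa++Y≢v (++-cancelˡ core _ _ (++-cancelˡ (X ++ reverse c) _ _ (begin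
        (X ++ reverse c) ++ core ++ c ++ Y               ≡⟨ shifted ⟩
        (img σ w ++ p) ++ v                              ≡⟨ cong (λ s → (img σ s ++ p) ++ v) ew′ ⟩
        (img σ (A ∷ʳ x ++ r ∷ R) ++ p) ++ v              ≡⟨ cong (λ s → (s ++ p) ++ v) (img-++ (A ∷ʳ x) (r ∷ R)) ⟩
        ((img σ (A ∷ʳ x) ++ img σ (r ∷ R)) ++ p) ++ v    ≡⟨ cong (λ s → ((s ++ img σ (r ∷ R)) ++ p) ++ v) (trans (sym eA) (eX d ec)) ⟩
        (((X ++ reverse c) ++ img σ (r ∷ R)) ++ p) ++ v  ≡⟨ cong (_++ v) (++-assoc (X ++ reverse c) _ p) ⟩
        ((X ++ reverse c) ++ core) ++ v                  ≡⟨ ++-assoc (X ++ reverse c) core v ⟩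
        (X ++ reverse c) ++ core ++ v                    ∎)))
        where
        ew′ : w ≡ A ∷ʳ x ++ r ∷ R
        ew′ = ∷ʳ-injectiveˡ w _ (trans ew (sym (++-assoc (A ∷ʳ x) (r ∷ R) [ x ])))

        v∷ʳa++Y≢v : ¬ c ++ Y ≡ v
        v∷ʳa++Y≢v e with () ← ++-cancelˡ v (a ∷ Y) [] (trans (sym (++-assoc v [ a ] Y)) (trans e (sym (++-identityʳ v))))

    step : AllNewPals (img σ w ++ p) → AllNewPals (img σ (w ∷ʳ x) ++ p)
    step old = subst AllNewPals (sym img-w-x-p) (allNewPals-++ (img σ w ++ p) (reverse (σ x)) old
      λ v a z e → let e′ = trans (++-assoc v [ a ] z) e in
        extension (v ∷ʳ a) z e′ , extension-pal (v ∷ʳ a) z e′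
        , subst (Suffix _) (sym (++-assoc (img σ w ++ p) v [ a ])) (extension-suffix (v ∷ʳ a) z e′)
        , extension-new v a z e′)

  -- Propagation along the prefixes of `t`.

  allNewPals-step : ∀ w x (N : NewPal w x) → ¬ length (proj₁ N) ≤ 2 →
                    AllNewPals (img σ w ++ p) → AllNewPals (img σ (w ∷ʳ x) ++ p)
  allNewPals-step w x ([] , _) 2<s = contradiction z≤n 2<s
  allNewPals-step w x (a ∷ s , ps , (T , eT) , s∉w) 2<s with initLast s
  ... | [] = contradiction (s≤s z≤n) 2<s
  ... | [] ∷ʳ′ b = contradiction ≤-refl 2<s
  -- More than two letters leave a non-empty middle; `pal-ends` makes the outer letters equal and
  -- the middle a palindrome.
  ... | (r ∷ R) ∷ʳ′ b
    with refl , refl ← ∷ʳ-injective (T ++ a ∷ r ∷ R) w (trans (++-assoc T (a ∷ r ∷ R) [ b ]) eT)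
    with refl , pR ← pal-ends a (r ∷ R) b ps = Step.step T x r R pR s∉w

  img-pref-allNewPals : ∀ t h → RichInf t → ShortPalsIn t h → AllNewPals (img σ (pref t h) ++ p) →
                        ∀ n → AllNewPals (img σ (pref t (h + n)) ++ p)
  img-pref-allNewPals t h rich short base 0 =
    subst (λ m → AllNewPals (img σ (pref t m) ++ p)) (sym (+-identityʳ h)) base
  img-pref-allNewPals t h rich short base (suc n) =
    subst (λ u → AllNewPals (img σ u ++ p)) (sym e)
      (allNewPals-step (pref t m) (t m) N long (img-pref-allNewPals t h rich short base n))
    where
    m = h + n
    e : pref t (h + suc n) ≡ pref t m ∷ʳ t m
    e = trans (cong (pref t) (+-suc h n)) (pref-suc t m)
    N : NewPal (pref t m) (t m)
    N = rich⇒allNewPals (pref t m ∷ʳ t m)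
          (rich _ (suc m , [] , [] , trans (++-identityʳ _) (sym (pref-suc t m)))) (pref t m) (t m) [] refl
    -- A new palindrome of length at most two would, by `short`, lie in the prefix of length `h`,
    -- which `pref t m` contains since `m` is `h + n`.
    long : ¬ length (proj₁ N) ≤ 2
    long le with s , ps , suf , s∉ ← N with z , _ , ez ← pref-+ t h n =
      s∉ (subst (Factor s) (sym ez) (factor-++ʳ z
        (short s (suc m , subst (Factor s) (sym (pref-suc t m)) (suffix⇒factor suf)) ps le)))

  -- The two implications.

  richImg⇒rich : ∀ t h → RichImg σ t → Rich (img σ (pref t h) ++ p)
  -- No letter has an empty image, so the next `length p` letters have an image at least as long as
  -- `p`. By `img-p-prefix` that image starts with `p`.
  richImg⇒rich t h rich with z , lz , ez ← pref-+ t h (length p)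
    with s , es ← img-p-prefix z
    with v , ev ← prefix-of-longer (img σ z) p es (subst (_≤ length (img σ z)) lz (length-img z)) =
    rich _ (h + length p , [] , v , (begin
      (img σ (pref t h) ++ p) ++ v       ≡⟨ ++-assoc (img σ (pref t h)) p v ⟩
      img σ (pref t h) ++ p ++ v         ≡⟨ cong (img σ (pref t h) ++_) ev ⟨
      img σ (pref t h) ++ img σ z        ≡⟨ img-++ (pref t h) z ⟨
      img σ (pref t h ++ z)              ≡⟨ cong (img σ) ez ⟨
      img σ (pref t (h + length p))      ∎))

  rich⇒richImg : ∀ t h → RichInf t → ShortPalsIn t h → Rich (img σ (pref t h) ++ p) → RichImg σ t
  -- Enlarging `n` by `h` gives a prefix length to which richness has been propagated; the factor at
  -- hand lies in the image of its first `n` letters.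
  rich⇒richImg t h rich short base u (n , fac) with z , _ , ez ← pref-+ t n h =
    rich-factor fac (rich-prefix (img σ (pref t n)) (rich-prefix (img σ (pref t n) ++ img σ z)
      (subst (λ s → Rich (s ++ p)) (trans (cong (img σ) (trans (cong (pref t) (+-comm h n)) ez)) (img-++ (pref t n) z))
        (allNewPals⇒rich _ (img-pref-allNewPals t h rich short (rich⇒allNewPals _ base) n)))))

theorem6p15 : ∀ {k : ℕ} (σ : Morphism k) (p : Word k) (t : InfWord k) (h : ℕ) →
    StandardP σ p → Special σ p → RichInf t → MinShortPalsIn t h →
    RichImg σ t ⇔ Rich (img σ (pref t h) ++ p)
theorem6p15 σ p t h standard special rich (short , _) = mk⇔ (richImg⇒rich t h) (rich⇒richImg t h rich short)
  where open SpecialMorphism σ p standard special
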